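{- Consider a step set $X\subseteq\mathbb{Z}^2\setminus\{O\}$. (i) If $X=\{A\}$, then $\mathcal{A}_X\cong(\mathbb{N},+)$. (ii) If $X=\{A,B\}$ where $A\neq B$ and $\angle AOB=0$, then $\mathcal{A}_X$ is isomorphic to a 2-generated submonoid of $(\mathbb{N},+)$. (iii) If $X=\{A,B\}$ where $\angle AOB=\pi$, then $\mathcal{A}_X\cong(\mathbb{Z},+)$. (iv) If $X=\{A,B\}$ where $0<\angle AOB<\pi$, then $\mathcal{A}_X\cong(\mathbb{N}\times\mathbb{N},+)$.
   Context: Write $O=(0,0)$ and $\mathbb{N}=\{0,1,2,\ldots\}$. A step set is any subset $X$ of $\mathbb{Z}^2\setminus\{O\}$, and $\mathcal{A}_X$ is the additive submonoid of $\mathbb{Z}^2$ generated by $X$ (with identity $O$). $\angle AOB\in[0,\pi]$ denotes the non-reflex angle between the segments $OA$ and $OB$. A submonoid of $\mathbb{N}$ is 2-generated if it is generated (as a monoid) by two elements. Isomorphisms are isomorphisms of monoids. -}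

module Defs where

open import Algebra.Bundles using (Monoid)
open import Algebra.Construct.DirectProduct using (monoid)
open import Algebra.Morphism.Structures using (module MonoidMorphisms)
open import Data.Empty using (⊥-elim-irr)
open import Data.Integer.Base as ℤ using (ℤ; +_; 0ℤ; ∣_∣)
import Data.Integer.Properties as ℤ
open import Data.Nat.Base as ℕ using (ℕ)
import Data.Nat.Properties as ℕ
open import Data.Product.Base using (Σ; ∃; ∃-syntax; _×_; _,_; proj₁; proj₂)
open import Data.Rational.Unnormalised.Base as ℚ using (ℚᵘ; 1ℚᵘ)
open import Data.Sum.Base using (inj₁; inj₂)
open import Level using (Level; 0ℓ; _⊔_; suc)
open import Relation.Binary.PropositionalEquality using (_≡_; _≢_; cong₂)
open import Relation.Unary using (Pred; _∈_; _≐_; _∪_; ｛_｝)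

private
  variable
    c c′ ℓ ℓ′ p : Level

------------------------------------------------------------------------
-- Monoids

_≅_ : Monoid c ℓ → Monoid c′ ℓ′ → Set (c ⊔ ℓ ⊔ c′ ⊔ ℓ′)
M ≅ N = ∃ (MonoidMorphisms.IsMonoidIsomorphism (Monoid.rawMonoid M) (Monoid.rawMonoid N))

infix 4 _≅_

module _ (M : Monoid c ℓ) where
  open Monoid M

  record Submonoid (p : Level) : Set (c ⊔ ℓ ⊔ suc p) where
    field
      Member    : Pred Carrier p
      ≈-closed  : ∀ {x y} → x ≈ y → x ∈ Member → y ∈ Member
      ε-closed  : ε ∈ Member
      ∙-closed  : ∀ {x y} → x ∈ Member → y ∈ Member → x ∙ y ∈ Member

    toMonoid : Monoid (c ⊔ p) ℓ
    toMonoid = record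
      { Carrier  = Σ Carrier Member
      ; _≈_      = λ x y → proj₁ x ≈ proj₁ y
      ; _∙_      = λ { (x , x∈) (y , y∈) → x ∙ y , ∙-closed x∈ y∈ }
      ; ε        = ε , ε-closed
      ; isMonoid = record
        { isSemigroup = record
          { isMagma = record
            { isEquivalence = record { refl = refl ; sym = sym ; trans = trans }
            ; ∙-cong        = ∙-cong
            }
          ; assoc = λ x y z → assoc (proj₁ x) (proj₁ y) (proj₁ z)
          }
        ; identity = (λ x → identityˡ (proj₁ x)) , (λ x → identityʳ (proj₁ x))
        }
      }

  data Generated (X : Pred Carrier p) : Pred Carrier (c ⊔ ℓ ⊔ p) where
    generator : ∀ {x} → x ∈ X → x ∈ Generated X
    unit      : ε ∈ Generated X
    product   : ∀ {x y} → x ∈ Generated X → y ∈ Generated X → x ∙ y ∈ Generated X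
    respects  : ∀ {x y} → x ≈ y → x ∈ Generated X → y ∈ Generated X

  generatedBy : Pred Carrier p → Submonoid (c ⊔ ℓ ⊔ p)
  generatedBy X = record
    { Member   = Generated X
    ; ≈-closed = respects
    ; ε-closed = unit
    ; ∙-closed = product
    }

  TwoGenerated : Submonoid p → Set (c ⊔ ℓ ⊔ p)
  TwoGenerated S =
    ∃[ a ] ∃[ b ] (a ≢ b) × Submonoid.Member S ≐ Generated (｛ a ｝ ∪ ｛ b ｝)

ℕ-monoid : Monoid 0ℓ 0ℓ
ℕ-monoid = ℕ.+-0-monoid

ℤ-monoid : Monoid 0ℓ 0ℓ
ℤ-monoid = ℤ.+-0-monoid

ℕ²-monoid : Monoid 0ℓ 0ℓ
ℕ²-monoid = monoid ℕ-monoid ℕ-monoid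

ℤ²-monoid : Monoid 0ℓ 0ℓ
ℤ²-monoid = monoid ℤ-monoid ℤ-monoid

------------------------------------------------------------------------
-- Steps

ℤ² : Set
ℤ² = ℤ × ℤ

O : ℤ²
O = 0ℤ , 0ℤ

-- The elements of ℤ² ∖ {O}.  The proof is irrelevant, so that steps are
-- propositionally equal as soon as their positions are.
record Step : Set where
  constructor step
  field
    position : ℤ²
    .nonzero : position ≢ O

open Step public

StepSet : (p : Level) → Set (suc p)
StepSet p = Pred Step p

𝒜 : StepSet p → Submonoid ℤ²-monoid p
𝒜 X = generatedBy ℤ²-monoid (λ P → ∃[ A ] A ∈ X × position A ≡ P)

------------------------------------------------------------------------
-- Angles

-- An angle θ ∈ [0,π] is recorded by the number cos θ · |cos θ|, which
-- determines θ because both cos : [0,π] → [-1,1] and t ↦ t · |t| are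
-- injective.  It is rational for angles between integer vectors.
record Angle : Set where
  constructor fromSignedCos²
  field
    signedCos² : ℚᵘ

open Angle public

infix 4 _≈∠_ _<∠_

_≈∠_ : Angle → Angle → Set
θ ≈∠ φ = signedCos² θ ℚ.≃ signedCos² φ

-- The order is reversed: cos is strictly decreasing on [0,π] and t ↦ t · |t| is
-- strictly increasing.
_<∠_ : Angle → Angle → Set
θ <∠ φ = signedCos² φ ℚ.< signedCos² θ

0∠ : Angle
0∠ = fromSignedCos² 1ℚᵘ

π : Angle
π = fromSignedCos² (ℚ.- 1ℚᵘ)

dot : ℤ² → ℤ² → ℤ
dot (x₁ , y₁) (x₂ , y₂) = x₁ ℤ.* x₂ ℤ.+ y₁ ℤ.* y₂

normSq : ℤ² → ℕ
normSq (x , y) = ∣ x ∣ ℕ.* ∣ x ∣ ℕ.+ ∣ y ∣ ℕ.* ∣ y ∣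

normSq≡0⇒≡O : ∀ P → normSq P ≡ 0 → P ≡ O
normSq≡0⇒≡O (x , y) eq = cong₂ _,_
  (square≡0 x (ℕ.m+n≡0⇒m≡0 (∣ x ∣ ℕ.* ∣ x ∣) eq))
  (square≡0 y (ℕ.m+n≡0⇒n≡0 (∣ x ∣ ℕ.* ∣ x ∣) eq))
  where
  square≡0 : ∀ i → ∣ i ∣ ℕ.* ∣ i ∣ ≡ 0 → i ≡ 0ℤ
  square≡0 i e with ℕ.m*n≡0⇒m≡0∨n≡0 ∣ i ∣ e
  ... | inj₁ z = ℤ.∣i∣≡0⇒i≡0 z
  ... | inj₂ z = ℤ.∣i∣≡0⇒i≡0 z

normSq-nonZero : ∀ A → ℕ.NonZero (normSq (position A))
normSq-nonZero (step P P≢O) =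
  ℕ.≢-nonZero (λ eq → ⊥-elim-irr (P≢O (normSq≡0⇒≡O P eq)))

-- From cos ∠AOB = (A · B) / (|A| |B|).
∠ : Step → Step → Angle
∠ A B = fromSignedCos²
  (((dot P Q ℤ.* + ∣ dot P Q ∣) ℚ./ (normSq P ℕ.* normSq Q))
    {{ℕ.m*n≢0 (normSq P) (normSq Q) {{normSq-nonZero A}} {{normSq-nonZero B}}}})
  where
  P = position A
  Q = position B

-- In each case a model monoid N embeds in ℤ² with image 𝒜 X: ℕ by n ↦ nA in (i)
-- and ℕ × ℕ by (m , n) ↦ mA + nB in (iv), where injectivity is the non-vanishing
-- of the cross product of A and B.  In (ii) and (iii) the cross product vanishes
-- by Lagrange's identity |A|²|B|² = (A · B)² + (A × B)².  Then |A|² B = (A · B) A;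
-- dividing |A|² and A · B by their gcd gives coprime a and b with aB = bA, so a
-- divides the coordinates of A, that is A = aD and B = bD for a lattice vector D,
-- and b has the sign of A · B.  The embedding is k ↦ kD, on the submonoid of ℕ
-- generated by a and b in (ii); in (iii) the image is all of ℤD by Bézout.

module Submission where

open import Defs
open import Algebra.Bundles using (Monoid)
open import Algebra.Morphism.Construct.Composition using (isMonoidMonomorphism)
open import Algebra.Morphism.Structures
  using (IsMonoidHomomorphism; IsMonoidMonomorphism)
open import Data.Empty using (⊥-elim-irr)
open import Data.Integer.Base as ℤ using (ℤ; +_; -[1+_]; 0ℤ; 1ℤ; -1ℤ; ∣_∣)
open import Data.Integer.Coprimality using (Coprime; coprime-divisor)
open import Data.Integer.Divisibility.Signed as ℤ using (∣ᵤ⇒∣; ∣⇒∣ᵤ)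
import Data.Integer.Properties as ℤ
open import Algebra.Properties.AbelianGroup ℤ.+-0-abelianGroup using (identityʳ-unique)
open import Data.Integer.Tactic.RingSolver using (solve-∀)
open import Data.Nat.Base as ℕ using (ℕ; zero; suc)
import Data.Nat.Coprimality as ℕ
open import Data.Nat.Divisibility as ℕ using (divides)
open import Data.Nat.GCD
  using (GCD; GCD-*; gcd; gcd-GCD; gcd[m,n]∣m; gcd[m,n]∣n; gcd[m,n]≢0; module Bézout)
import Data.Nat.Properties as ℕ
open import Data.Product.Base using (∃-syntax; _×_; _,_; proj₁; proj₂)
open import Data.Rational.Unnormalised.Base as ℚ using (mkℚᵘ; ↥_; ↧_)
import Data.Rational.Unnormalised.Properties as ℚ
open import Data.Sum.Base using (_⊎_; inj₁; inj₂; reduce)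
open import Function.Base using (id; _∘_)
open import Level using (Level; 0ℓ)
open import Relation.Binary.PropositionalEquality
  using (_≡_; _≢_; refl; sym; trans; cong; cong₂; subst; subst₂; module ≡-Reasoning)
open import Relation.Nullary using (yes; no; contradiction)
open import Relation.Unary using (Pred; _∈_; _≐_; _∪_; ｛_｝)

private
  variable
    c c′ ℓ ℓ′ p q : Level

-- Monoids

module _ {M : Monoid c ℓ} {N : Monoid c′ ℓ′} where
  private
    module M = Monoid M
    module N = Monoid N

  -- Pulling `𝒜 X` back along k ↦ kD turns questions about lattice vectors into questions about sets
  -- of scalars.
  preimage : ∀ {f} → IsMonoidHomomorphism N.rawMonoid M.rawMonoid f →
             Submonoid M p → Submonoid N p
  preimage {f = f} hom S = record
    { Member   = λ n → f n ∈ S.Member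
    ; ≈-closed = λ m≈n → S.≈-closed (⟦⟧-cong m≈n)
    ; ε-closed = S.≈-closed (M.sym ε-homo) S.ε-closed
    ; ∙-closed = λ m∈ n∈ → S.≈-closed (M.sym (homo _ _)) (S.∙-closed m∈ n∈)
    }
    where
    module S = Submonoid S
    open IsMonoidHomomorphism hom

  -- The image of `f` is a submonoid containing `X`, so it contains everything generated, and `f`
  -- can be inverted there. Each law for the inverse is checked after applying the injective `f`.
  monomorphism⇒≅ : ∀ {X : Pred M.Carrier p} {f} →
    IsMonoidMonomorphism N.rawMonoid M.rawMonoid f →
    (∀ n → f n ∈ Generated M X) →
    (∀ {x} → x ∈ X → ∃[ n ] f n M.≈ x) →
    Submonoid.toMonoid (generatedBy M X) ≅ N
  monomorphism⇒≅ {X = X} {f} mono f∈ X⊆f = f⁻¹ , record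
    { isMonoidMonomorphism = record
      { isMonoidHomomorphism = record
        { isMagmaHomomorphism = record
          { isRelHomomorphism = record { cong = λ {x} {y} → f⁻¹-cong x y }
          ; homo = λ x y → injective (M.trans (f∘f⁻¹ (x ∙ y))
              (M.sym (M.trans (homo _ _) (M.∙-cong (f∘f⁻¹ x) (f∘f⁻¹ y)))))
          }
        ; ε-homo = injective (M.trans (f∘f⁻¹ ε) (M.sym ε-homo))
        }
      ; injective = λ {x} {y} eq →
          M.trans (M.sym (f∘f⁻¹ x)) (M.trans (⟦⟧-cong eq) (f∘f⁻¹ y))
      }
    ; surjective = λ n → (f n , f∈ n) ,
        λ {z} z≈ → injective (M.trans (f∘f⁻¹ z) z≈)
    }
    where
    open IsMonoidMonomorphism mono
    open Monoid (Submonoid.toMonoid (generatedBy M X)) using (Carrier; _∙_; ε)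

    -- The preimage is read off the derivation that x is generated. Different derivations for the
    -- same x give equal preimages, by injectivity of `f`.
    inImage : ∀ {x} → x ∈ Generated M X → ∃[ n ] f n M.≈ x
    inImage (generator x∈)   = X⊆f x∈
    inImage unit             = N.ε , ε-homo
    inImage (product x∈ y∈)  = let m , fm≈x = inImage x∈ ; n , fn≈y = inImage y∈ in
      m N.∙ n , M.trans (homo m n) (M.∙-cong fm≈x fn≈y)
    inImage (respects x≈ x∈) = let m , fm≈x = inImage x∈ in m , M.trans fm≈x x≈

    f⁻¹ : Carrier → N.Carrier
    f⁻¹ (_ , x∈) = proj₁ (inImage x∈)

    f∘f⁻¹ : ∀ x → f (f⁻¹ x) M.≈ proj₁ x
    f∘f⁻¹ (_ , x∈) = proj₂ (inImage x∈)

    f⁻¹-cong : ∀ x y → proj₁ x M.≈ proj₁ y → f⁻¹ x N.≈ f⁻¹ y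
    f⁻¹-cong x y x≈y = injective (M.trans (f∘f⁻¹ x) (M.trans x≈y (M.sym (f∘f⁻¹ y))))

module _ {M : Monoid c ℓ} where
  private module M = Monoid M

  generated-least : ∀ {X : Pred M.Carrier q} (S : Submonoid M p) →
    (∀ {x} → x ∈ X → x ∈ Submonoid.Member S) →
    ∀ {x} → x ∈ Generated M X → x ∈ Submonoid.Member S
  generated-least S X⊆S = go
    where
    open Submonoid S
    go : ∀ {x} → x ∈ Generated M _ → x ∈ Member
    go (generator x∈)   = X⊆S x∈
    go unit             = ε-closed
    go (product x∈ y∈)  = ∙-closed (go x∈) (go y∈)
    go (respects x≈ x∈) = ≈-closed x≈ (go x∈)

  inclusion-isMonoidMonomorphism : (S : Submonoid M p) →
    IsMonoidMonomorphism (Monoid.rawMonoid (Submonoid.toMonoid S)) M.rawMonoid proj₁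
  inclusion-isMonoidMonomorphism S = record
    { isMonoidHomomorphism = record
      { isMagmaHomomorphism = record
        { isRelHomomorphism = record { cong = id }
        ; homo = λ _ _ → M.refl
        }
      ; ε-homo = M.refl
      }
    ; injective = id
    }

+-isMonoidMonomorphism :
  IsMonoidMonomorphism (Monoid.rawMonoid ℕ-monoid) (Monoid.rawMonoid ℤ-monoid) +_
+-isMonoidMonomorphism = record
  { isMonoidHomomorphism = record
    { isMagmaHomomorphism = record
      { isRelHomomorphism = record { cong = cong +_ }
      ; homo = ℤ.pos-+
      }
    ; ε-homo = refl
    }
  ; injective = ℤ.+-injective
  }

-- Submonoids of ℤ.

module _ (S : Submonoid ℤ-monoid p) where
  open Submonoid S

  multiple-closed : ∀ n {k} → k ∈ Member → + n ℤ.* k ∈ Member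
  multiple-closed zero    {k} k∈ = subst Member (sym (ℤ.*-zeroˡ k)) ε-closed
  multiple-closed (suc n) {k} k∈ =
    subst Member (sym (ℤ.suc-* (+ n) k)) (∙-closed k∈ (multiple-closed n k∈))

  ±1⇒full : 1ℤ ∈ Member → -1ℤ ∈ Member → ∀ k → k ∈ Member
  ±1⇒full 1∈ -1∈ (+ n)    = subst Member (ℤ.*-identityʳ (+ n)) (multiple-closed n 1∈)
  ±1⇒full 1∈ -1∈ -[1+ n ] = subst Member
    (trans (ℤ.*-comm (+ suc n) -1ℤ) (ℤ.-1*i≡-i (+ suc n))) (multiple-closed (suc n) -1∈)

  -- Bézout over ℕ expresses 1 or -1 as x(a + 1) - y(b + 1) with x, y ≥ 0, according to which side
  -- is larger. The other unit is then reached from the generator of opposite sign.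
  coprime⇒full : ∀ {a b} → ℕ.Coprime (suc a) (suc b) →
                 + suc a ∈ Member → -[1+ b ] ∈ Member → ∀ k → k ∈ Member
  coprime⇒full {a} {b} coprime a∈ -b∈ with ℕ.coprime-Bézout coprime
  ... | Bézout.+- x y eq = ±1⇒full 1∈ (subst Member b-1≡ (∙-closed -b∈ (multiple-closed b 1∈)))
    where
    lift : 1ℤ ℤ.+ + y ℤ.* + suc b ≡ + x ℤ.* + suc a
    lift = trans (cong (ℤ._+_ 1ℤ) (sym (ℤ.pos-* y (suc b))))
             (trans (sym (ℤ.pos-+ 1 (y ℕ.* suc b))) (trans (cong +_ eq) (ℤ.pos-* x (suc a))))
    cancel : ∀ u v w → u ℤ.+ v ℤ.* w ℤ.+ v ℤ.* ℤ.- w ≡ u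
    cancel = solve-∀
    1∈ : 1ℤ ∈ Member
    1∈ = subst Member
      (trans (cong (ℤ._+ (+ y ℤ.* -[1+ b ])) (sym lift)) (cancel 1ℤ (+ y) (+ suc b)))
      (∙-closed (multiple-closed x a∈) (multiple-closed y -b∈))
    -- `-[1+ b ]` is -(b + 1), so adding 1 only b times leaves -1.
    b-1 : ∀ u → ℤ.- (1ℤ ℤ.+ u) ℤ.+ u ℤ.* 1ℤ ≡ -1ℤ
    b-1 = solve-∀
    b-1≡ : -[1+ b ] ℤ.+ + b ℤ.* 1ℤ ≡ -1ℤ
    b-1≡ = b-1 (+ b)
  ... | Bézout.-+ x y eq = ±1⇒full (subst Member (a-1 (+ a)) (∙-closed a∈ (multiple-closed a -1∈))) -1∈
    where
    lift : 1ℤ ℤ.+ + x ℤ.* + suc a ≡ + y ℤ.* + suc b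
    lift = trans (cong (ℤ._+_ 1ℤ) (sym (ℤ.pos-* x (suc a))))
             (trans (sym (ℤ.pos-+ 1 (x ℕ.* suc a))) (trans (cong +_ eq) (ℤ.pos-* y (suc b))))
    cancel : ∀ u v w → u ℤ.+ v ℤ.* ℤ.- w ≡ ℤ.- (v ℤ.* w ℤ.- u)
    cancel = solve-∀
    uncancel : ∀ u v → ℤ.- (u ℤ.+ v ℤ.- v) ≡ ℤ.- u
    uncancel = solve-∀
    -1∈ : -1ℤ ∈ Member
    -1∈ = subst Member
      (trans (cancel (+ x ℤ.* + suc a) (+ y) (+ suc b))
        (trans (cong (λ t → ℤ.- (t ℤ.- + x ℤ.* + suc a)) (sym lift))
          (uncancel 1ℤ (+ x ℤ.* + suc a))))
      (∙-closed (multiple-closed x a∈) (multiple-closed y -b∈))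
    a-1 : ∀ u → 1ℤ ℤ.+ u ℤ.+ u ℤ.* -1ℤ ≡ 1ℤ
    a-1 = solve-∀

-- Lattice vectors

infixr 7 _·_
infixl 6 _⊕_

_⊕_ : ℤ² → ℤ² → ℤ²
_⊕_ = Monoid._∙_ ℤ²-monoid

_·_ : ℤ → ℤ² → ℤ²
k · (x , y) = k ℤ.* x , k ℤ.* y

-- The determinant of the matrix with these two rows.
cross : ℤ² → ℤ² → ℤ
cross (x₁ , y₁) (x₂ , y₂) = x₁ ℤ.* y₂ ℤ.- y₁ ℤ.* x₂

·-injective : ∀ {P} → P ≢ O → ∀ {k l} → k · P ≡ l · P → k ≡ l
·-injective {x , y} P≢O {k} {l} eq with x ℤ.≟ 0ℤ | y ℤ.≟ 0ℤ
... | yes refl | yes refl = contradiction refl P≢O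
... | no x≢0   | _        = ℤ.*-cancelʳ-≡ k l x {{ℤ.≢-nonZero x≢0}} (cong proj₁ eq)
... | yes _    | no y≢0   = ℤ.*-cancelʳ-≡ k l y {{ℤ.≢-nonZero y≢0}} (cong proj₂ eq)

·-isMonoidMonomorphism : ∀ {P} → P ≢ O →
  IsMonoidMonomorphism (Monoid.rawMonoid ℤ-monoid) (Monoid.rawMonoid ℤ²-monoid) (_· P)
·-isMonoidMonomorphism {P@(x , y)} P≢O = record
  { isMonoidHomomorphism = record
    { isMagmaHomomorphism = record
      { isRelHomomorphism = record { cong = λ { refl → refl , refl } }
      ; homo = λ k l → ℤ.*-distribʳ-+ x k l , ℤ.*-distribʳ-+ y k l
      }
    ; ε-homo = refl , refl
    }
  ; injective = λ { {k} {l} (eq₁ , eq₂) → ·-injective P≢O {k} {l} (cong₂ _,_ eq₁ eq₂) }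
  }

combination : ℤ² → ℤ² → ℕ × ℕ → ℤ²
combination P Q (m , n) = + m · P ⊕ + n · Q

-- Cramer's rule: `cross` is bilinear and vanishes on equal arguments, so crossing with `Q` isolates
-- the coefficient of `P`.
cross-combinationʳ : ∀ P Q m n → cross (combination P Q (m , n)) Q ≡ + m ℤ.* cross P Q
cross-combinationʳ (x₁ , y₁) (x₂ , y₂) m n = identity (+ m) (+ n) x₁ y₁ x₂ y₂
  where
  identity : ∀ m n x₁ y₁ x₂ y₂ →
    (m ℤ.* x₁ ℤ.+ n ℤ.* x₂) ℤ.* y₂ ℤ.- (m ℤ.* y₁ ℤ.+ n ℤ.* y₂) ℤ.* x₂ ≡
    m ℤ.* (x₁ ℤ.* y₂ ℤ.- y₁ ℤ.* x₂)
  identity = solve-∀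

cross-combinationˡ : ∀ P Q m n → cross P (combination P Q (m , n)) ≡ + n ℤ.* cross P Q
cross-combinationˡ (x₁ , y₁) (x₂ , y₂) m n = identity (+ m) (+ n) x₁ y₁ x₂ y₂
  where
  identity : ∀ m n x₁ y₁ x₂ y₂ →
    x₁ ℤ.* (m ℤ.* y₁ ℤ.+ n ℤ.* y₂) ℤ.- y₁ ℤ.* (m ℤ.* x₁ ℤ.+ n ℤ.* x₂) ≡
    n ℤ.* (x₁ ℤ.* y₂ ℤ.- y₁ ℤ.* x₂)
  identity = solve-∀

combination-isMonoidMonomorphism : ∀ {P Q} → cross P Q ≢ 0ℤ →
  IsMonoidMonomorphism (Monoid.rawMonoid ℕ²-monoid) (Monoid.rawMonoid ℤ²-monoid)
    (combination P Q)
combination-isMonoidMonomorphism {P@(x₁ , y₁)} {Q@(x₂ , y₂)} P×Q≢0 = record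
  { isMonoidHomomorphism = record
    { isMagmaHomomorphism = record
      { isRelHomomorphism = record { cong = λ { (refl , refl) → refl , refl } }
      ; homo = λ (m , n) (m′ , n′) → distrib m n m′ n′ x₁ x₂ , distrib m n m′ n′ y₁ y₂
      }
    ; ε-homo = refl , refl
    }
  ; injective = λ { {m , n} {m′ , n′} (eq₁ , eq₂) → let eq = cong₂ _,_ eq₁ eq₂ in
        cancel (trans (sym (cross-combinationʳ P Q m n))
          (trans (cong (λ R → cross R Q) eq) (cross-combinationʳ P Q m′ n′)))
      , cancel (trans (sym (cross-combinationˡ P Q m n))
          (trans (cong (cross P) eq) (cross-combinationˡ P Q m′ n′))) }
  }
  where
  distrib′ : ∀ m n m′ n′ u v →
    (m ℤ.+ m′) ℤ.* u ℤ.+ (n ℤ.+ n′) ℤ.* v ≡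
    (m ℤ.* u ℤ.+ n ℤ.* v) ℤ.+ (m′ ℤ.* u ℤ.+ n′ ℤ.* v)
  distrib′ = solve-∀

  distrib : ∀ m n m′ n′ u v →
    + (m ℕ.+ m′) ℤ.* u ℤ.+ + (n ℕ.+ n′) ℤ.* v ≡
    (+ m ℤ.* u ℤ.+ + n ℤ.* v) ℤ.+ (+ m′ ℤ.* u ℤ.+ + n′ ℤ.* v)
  -- `+ (m ℕ.+ m′)` and `+ m ℤ.+ + m′` agree by computation, so the ring identity over ℤ applies
  -- directly.
  distrib m n m′ n′ u v = distrib′ (+ m) (+ n) (+ m′) (+ n′) u v

  cancel : ∀ {m n} → + m ℤ.* cross P Q ≡ + n ℤ.* cross P Q → m ≡ n
  cancel {m} {n} = ℤ.+-injective ∘ ℤ.*-cancelʳ-≡ (+ m) (+ n) _ {{ℤ.≢-nonZero P×Q≢0}}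

-- Lagrange's identity and collinear vectors.

i*∣i∣≡±i² : ∀ i → i ℤ.* + ∣ i ∣ ≡ i ℤ.* i ⊎ i ℤ.* + ∣ i ∣ ≡ ℤ.- (i ℤ.* i)
i*∣i∣≡±i² (+ _)    = inj₁ refl
i*∣i∣≡±i² -[1+ _ ] = inj₂ refl

+∣i∣²≡i² : ∀ i → + (∣ i ∣ ℕ.* ∣ i ∣) ≡ i ℤ.* i
+∣i∣²≡i² (+ n)    = ℤ.pos-* n n
+∣i∣²≡i² -[1+ n ] = refl

+normSq : ∀ P → + normSq P ≡ dot P P
+normSq (x , y) = trans (ℤ.pos-+ (∣ x ∣ ℕ.* ∣ x ∣) _) (cong₂ ℤ._+_ (+∣i∣²≡i² x) (+∣i∣²≡i² y))

lagrange : ∀ P Q → + (normSq P ℕ.* normSq Q) ≡ dot P Q ℤ.* dot P Q ℤ.+ cross P Q ℤ.* cross P Q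
lagrange P@(x₁ , y₁) Q@(x₂ , y₂) = begin
  + (normSq P ℕ.* normSq Q)     ≡⟨ ℤ.pos-* (normSq P) (normSq Q) ⟩
  + normSq P ℤ.* + normSq Q     ≡⟨ cong₂ ℤ._*_ (+normSq P) (+normSq Q) ⟩
  dot P P ℤ.* dot Q Q           ≡⟨ identity x₁ y₁ x₂ y₂ ⟩
  dot P Q ℤ.* dot P Q ℤ.+ cross P Q ℤ.* cross P Q ∎
  where
  open ≡-Reasoning
  identity : ∀ x₁ y₁ x₂ y₂ →
    (x₁ ℤ.* x₁ ℤ.+ y₁ ℤ.* y₁) ℤ.* (x₂ ℤ.* x₂ ℤ.+ y₂ ℤ.* y₂) ≡
    (x₁ ℤ.* x₂ ℤ.+ y₁ ℤ.* y₂) ℤ.* (x₁ ℤ.* x₂ ℤ.+ y₁ ℤ.* y₂) ℤ.+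
    (x₁ ℤ.* y₂ ℤ.- y₁ ℤ.* x₂) ℤ.* (x₁ ℤ.* y₂ ℤ.- y₁ ℤ.* x₂)
  identity = solve-∀

-- This is the equality case of Cauchy-Schwarz: by `lagrange` the gap is the square of the cross
-- product, and ℤ has no zero divisors.
dot²≡normSq*⇒cross≡0 : ∀ P Q → dot P Q ℤ.* dot P Q ≡ + (normSq P ℕ.* normSq Q) → cross P Q ≡ 0ℤ
dot²≡normSq*⇒cross≡0 P Q eq = reduce (ℤ.i*j≡0⇒i≡0∨j≡0 _ c²≡0)
  where
  c²≡0 : cross P Q ℤ.* cross P Q ≡ 0ℤ
  c²≡0 = identityʳ-unique (dot P Q ℤ.* dot P Q) _ (sym (trans eq (lagrange P Q)))

cross≡0⇒dot²≡normSq* : ∀ P Q → cross P Q ≡ 0ℤ → dot P Q ℤ.* dot P Q ≡ + (normSq P ℕ.* normSq Q)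
cross≡0⇒dot²≡normSq* P Q eq = sym (trans (lagrange P Q)
  (trans (cong (λ c → dot P Q ℤ.* dot P Q ℤ.+ c ℤ.* c) eq) (ℤ.+-identityʳ _)))

-- Orthogonal decomposition of Q along P = (x₁, y₁): |P|² Q = (P · Q) P + (P × Q) (-y₁, x₁), whose
-- last term vanishes.
collinear : ∀ P Q → cross P Q ≡ 0ℤ → dot P P · Q ≡ dot P Q · P
collinear (x₁ , y₁) (x₂ , y₂) eq = cong₂ _,_
  (trans (identity₁ x₁ y₁ x₂ y₂) (vanish y₁ _))
  -- The double negation of x₁ gives both coordinates the shape that `vanish` expects.
  (trans (identity₂ x₁ y₁ x₂ y₂) (vanish (ℤ.- x₁) _))
  where
  vanish : ∀ u v → v ℤ.- u ℤ.* (x₁ ℤ.* y₂ ℤ.- y₁ ℤ.* x₂) ≡ v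
  vanish u v rewrite eq | ℤ.*-zeroʳ u = ℤ.+-identityʳ v
  identity₁ : ∀ x₁ y₁ x₂ y₂ →
    (x₁ ℤ.* x₁ ℤ.+ y₁ ℤ.* y₁) ℤ.* x₂ ≡
    (x₁ ℤ.* x₂ ℤ.+ y₁ ℤ.* y₂) ℤ.* x₁ ℤ.- y₁ ℤ.* (x₁ ℤ.* y₂ ℤ.- y₁ ℤ.* x₂)
  identity₁ = solve-∀
  identity₂ : ∀ x₁ y₁ x₂ y₂ →
    (x₁ ℤ.* x₁ ℤ.+ y₁ ℤ.* y₁) ℤ.* y₂ ≡
    (x₁ ℤ.* x₂ ℤ.+ y₁ ℤ.* y₂) ℤ.* y₁ ℤ.- (ℤ.- x₁) ℤ.* (x₁ ℤ.* y₂ ℤ.- y₁ ℤ.* x₂)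
  identity₂ = solve-∀

-- The first coefficient is |P|² over the gcd, hence a successor. The last component makes the dot
-- product a positive multiple of `b`, which fixes the sign of `b`.
common-divisor : ∀ P Q → P ≢ O → cross P Q ≡ 0ℤ →
  ∃[ a ] ∃[ b ] ∃[ D ] Coprime (+ suc a) b × P ≡ + suc a · D × Q ≡ b · D ×
    ∃[ g ] dot P Q ≡ b ℤ.* + suc g
common-divisor P@(x₁ , y₁) Q@(x₂ , y₂) P≢O P×Q≡0 =
  divide (gcd[m,n]∣m n ∣ d ∣) (∣ᵤ⇒∣ (gcd[m,n]∣n n ∣ d ∣))
  where
  n = normSq P
  d = dot P Q
  g = gcd n ∣ d ∣

  n≢0 : n ≢ 0
  n≢0 = P≢O ∘ normSq≡0⇒≡O P

  instance
    g≢0 : ℕ.NonZero g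
    g≢0 = ℕ.≢-nonZero (gcd[m,n]≢0 n ∣ d ∣ (inj₁ n≢0))

  divide : g ℕ.∣ n → + g ℤ.∣ d →
    ∃[ a ] ∃[ b ] ∃[ D ] Coprime (+ suc a) b × P ≡ + suc a · D × Q ≡ b · D ×
      ∃[ g ] d ≡ b ℤ.* + suc g
  divide (divides zero n≡0) _ = contradiction n≡0 n≢0
  divide (divides a@(suc a-1) n≡ag) (ℤ.divides b d≡bg) =
    let x , x₁≡ax , x₂≡bx = coordinate x₁ x₂ (cong proj₁ (collinear P Q P×Q≡0))
        y , y₁≡ay , y₂≡by = coordinate y₁ y₂ (cong proj₂ (collinear P Q P×Q≡0))
    in a-1 , b , (x , y) , coprime , cong₂ _,_ x₁≡ax y₁≡ay , cong₂ _,_ x₂≡bx y₂≡by ,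
       ℕ.pred g , trans d≡bg (cong (λ m → b ℤ.* + m) (sym (ℕ.suc-pred g)))
    where
    coprime : Coprime (+ a) b
    -- The gcd of a · g and |b| · g is g = 1 · g; cancelling g leaves gcd 1.
    coprime = ℕ.GCD≡1⇒coprime (GCD-* (subst (GCD (a ℕ.* g) (∣ b ∣ ℕ.* g)) (sym (ℕ.*-identityˡ g))
      (subst₂ (λ m k → GCD m k g) n≡ag (trans (cong ∣_∣ d≡bg) (ℤ.abs-* b (+ g))) (gcd-GCD n ∣ d ∣))))

    n≡ga : dot P P ≡ + g ℤ.* + a
    n≡ga = trans (sym (+normSq P)) (trans (cong +_ (trans n≡ag (ℕ.*-comm a g))) (ℤ.pos-* g a))

    -- Cancelling `g` gives av = bu. Since a is coprime to b it divides u, and the quotient w is a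
    -- coordinate of `D`.
    coordinate : ∀ u v → dot P P ℤ.* v ≡ d ℤ.* u → ∃[ w ] u ≡ + a ℤ.* w × v ≡ b ℤ.* w
    coordinate u v nv≡du = w , u≡aw , v≡bw
      where
      open ≡-Reasoning
      av≡bu : + a ℤ.* v ≡ b ℤ.* u
      av≡bu = ℤ.*-cancelˡ-≡ (+ g) (+ a ℤ.* v) (b ℤ.* u) (begin
        + g ℤ.* (+ a ℤ.* v)   ≡⟨ ℤ.*-assoc (+ g) (+ a) v ⟨
        + g ℤ.* + a ℤ.* v     ≡⟨ cong (ℤ._* v) n≡ga ⟨
        dot P P ℤ.* v         ≡⟨ nv≡du ⟩
        d ℤ.* u               ≡⟨ cong (ℤ._* u) (trans d≡bg (ℤ.*-comm b (+ g))) ⟩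
        + g ℤ.* b ℤ.* u       ≡⟨ ℤ.*-assoc (+ g) b u ⟩
        + g ℤ.* (b ℤ.* u)     ∎)

      a∣u : + a ℤ.∣ u
      a∣u = ∣ᵤ⇒∣ (coprime-divisor (+ a) b u coprime
        (∣⇒∣ᵤ (ℤ.divides v (trans (sym av≡bu) (ℤ.*-comm (+ a) v)))))

      w = ℤ.quotient a∣u

      u≡aw : u ≡ + a ℤ.* w
      u≡aw = trans (ℤ._∣_.equality a∣u) (ℤ.*-comm w (+ a))

      v≡bw : v ≡ b ℤ.* w
      v≡bw = ℤ.*-cancelˡ-≡ (+ a) v (b ℤ.* w) (begin
        + a ℤ.* v           ≡⟨ av≡bu ⟩
        b ℤ.* u             ≡⟨ cong (b ℤ.*_) (ℤ._∣_.equality a∣u) ⟩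
        b ℤ.* (w ℤ.* + a)   ≡⟨ ℤ.*-assoc b w (+ a) ⟨
        b ℤ.* w ℤ.* + a     ≡⟨ ℤ.*-comm (b ℤ.* w) (+ a) ⟩
        + a ℤ.* (b ℤ.* w)   ∎)

-- Angles

-- The irrelevant proof stored in a step may be used only to derive absurdity, which is all that a
-- negation asks for.
position≢O : ∀ A → position A ≢ O
position≢O (step _ P≢O) eq = ⊥-elim-irr (P≢O eq)

module _ (A B : Step) where
  private
    P = position A
    Q = position B
    d = dot P Q
    nn = normSq P ℕ.* normSq Q

    instance
      nn≢0 : ℕ.NonZero nn
      nn≢0 = ℕ.m*n≢0 (normSq P) (normSq Q) {{normSq-nonZero A}} {{normSq-nonZero B}}

    ↥∠ : ↥ signedCos² (∠ A B) ≡ d ℤ.* + ∣ d ∣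
    ↥∠ = ℚ.↥[n/d]≡n _ nn

    ↧∠ : ↧ signedCos² (∠ A B) ≡ + nn
    ↧∠ = ℚ.↧[n/d]≡d (d ℤ.* + ∣ d ∣) nn

  -- `mkℚᵘ k 0` is k over 1, the second field being the denominator minus one; k = 1 gives `0∠` and
  -- k = -1 gives `π`.
  ∠≈⇒ : ∀ {k} → ∠ A B ≈∠ fromSignedCos² (mkℚᵘ k 0) → d ℤ.* + ∣ d ∣ ≡ k ℤ.* + nn
  ∠≈⇒ {k} eq = begin
    d ℤ.* + ∣ d ∣                      ≡⟨ ↥∠ ⟨
    ↥ signedCos² (∠ A B)              ≡⟨ ℤ.*-identityʳ _ ⟨
    ↥ signedCos² (∠ A B) ℤ.* 1ℤ       ≡⟨ ℚ.drop-*≡* eq ⟩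
    k ℤ.* ↧ signedCos² (∠ A B)        ≡⟨ cong (k ℤ.*_) ↧∠ ⟩
    k ℤ.* + nn                        ∎
    where open ≡-Reasoning

  ∠≈0⇒ : ∠ A B ≈∠ 0∠ → cross P Q ≡ 0ℤ × ∃[ n ] d ≡ + n
  ∠≈0⇒ eq with d in d≡ | trans (∠≈⇒ eq) (ℤ.*-identityˡ (+ nn))
  ... | + n      | dd≡nn = dot²≡normSq*⇒cross≡0 P Q (trans (cong₂ ℤ._*_ d≡ d≡) dd≡nn) , n , refl
  ... | -[1+ _ ] | ()

  ∠≈π⇒ : ∠ A B ≈∠ π → cross P Q ≡ 0ℤ × ∃[ n ] d ≡ -[1+ n ]
  ∠≈π⇒ eq with d in d≡ | trans (∠≈⇒ eq) (ℤ.-1*i≡-i (+ nn))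
  ... | + n      | dd≡-nn = contradiction (trans (ℤ.pos-* n n) dd≡-nn) (+≢- nn)
    where
    -- Positivity of the norms matters here: `ℤ.- + 0` is `+ 0`.
    +≢- : ∀ m .{{_ : ℕ.NonZero m}} {k} → + k ≢ ℤ.- + m
    +≢- (suc _) ()
  ... | -[1+ n ] | dd≡-nn =
    -- For negative d the product d |d| computes to -d², so a sign is stripped from both sides.
    dot²≡normSq*⇒cross≡0 P Q (trans (cong₂ ℤ._*_ d≡ d≡) (ℤ.neg-injective dd≡-nn)) , n , refl

  0<∠⇒ : 0∠ <∠ ∠ A B → d ℤ.* + ∣ d ∣ ℤ.< + nn
  0<∠⇒ lt = subst₂ ℤ._<_ (trans (ℤ.*-identityʳ _) ↥∠) (trans (ℤ.*-identityˡ _) ↧∠)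
    (ℚ.drop-*<* lt)

  ∠<π⇒ : ∠ A B <∠ π → ℤ.- + nn ℤ.< d ℤ.* + ∣ d ∣
  ∠<π⇒ lt = subst₂ ℤ._<_ (trans (ℤ.-1*i≡-i _) (cong ℤ.-_ ↧∠)) (trans (ℤ.*-identityʳ _) ↥∠)
    (ℚ.drop-*<* lt)

  -- For collinear vectors d² = |P|² |Q|², so d |d| is one of the two extreme values, each excluded
  -- by one of the strict bounds.
  0<∠<π⇒cross≢0 : 0∠ <∠ ∠ A B → ∠ A B <∠ π → cross P Q ≢ 0ℤ
  0<∠<π⇒cross≢0 0<∠ ∠<π cross≡0 with i*∣i∣≡±i² d
  ... | inj₁ eq = ℤ.<-irrefl (trans eq (cross≡0⇒dot²≡normSq* P Q cross≡0)) (0<∠⇒ 0<∠)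
  ... | inj₂ eq =
    ℤ.<-irrefl (sym (trans eq (cong ℤ.-_ (cross≡0⇒dot²≡normSq* P Q cross≡0)))) (∠<π⇒ ∠<π)

steps-≡ : ∀ {A B} → position A ≡ position B → A ≡ B
steps-≡ {step _ _} {step _ _} refl = refl

divisor≢O : ∀ A k {D} → position A ≡ k · D → D ≢ O
divisor≢O A k A≡kD refl =
  position≢O A (trans A≡kD (cong₂ _,_ (ℤ.*-zeroʳ k) (ℤ.*-zeroʳ k)))

-- The four cases.

module _ (X : StepSet p) where
  open Monoid ℤ²-monoid using (_≈_; reflexive) renaming (sym to ≈-sym; trans to ≈-trans)
  open Submonoid (𝒜 X) using (Member; toMonoid; ≈-closed; ∙-closed)
  open IsMonoidMonomorphism using (isMonoidHomomorphism)

  private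
    1· : ∀ P → 1ℤ · P ≈ P
    1· (x , y) = ℤ.*-identityˡ x , ℤ.*-identityˡ y

    step∈ : ∀ {A P} → A ∈ X → position A ≈ P → P ∈ Member
    step∈ A∈ A≈P = ≈-closed A≈P (generator (_ , A∈ , refl))

    multiples∈ : ∀ {A} → A ∈ X → ∀ n → + n · position A ∈ Member
    multiples∈ {A} A∈ n = subst (λ k → k · position A ∈ Member) (ℤ.*-identityʳ (+ n))
      -- The scalars k with k · `position A` in `𝒜 X` form a submonoid of ℤ containing 1.
      (multiple-closed
        (preimage (isMonoidHomomorphism (·-isMonoidMonomorphism (position≢O A))) (𝒜 X)) n
        (step∈ A∈ (≈-sym (1· (position A)))))

  singleton⇒ℕ : ∀ A → X ≐ ｛ A ｝ → toMonoid ≅ ℕ-monoid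
  singleton⇒ℕ A (X⊆ , ⊆X) = monomorphism⇒≅ {N = ℕ-monoid}
    (isMonoidMonomorphism ≈-trans +-isMonoidMonomorphism (·-isMonoidMonomorphism (position≢O A)))
    (multiples∈ (⊆X refl))
    λ { (_ , A∈ , refl) → 1 , single (X⊆ A∈) }
    where
    single : ∀ {B} → A ≡ B → 1ℤ · position A ≈ position B
    single refl = 1· (position A)

  module _ {A B : Step} (X≐ : X ≐ ｛ A ｝ ∪ ｛ B ｝) where
    private
      P = position A
      Q = position B
      A∈ = proj₂ X≐ (inj₁ refl)
      B∈ = proj₂ X≐ (inj₂ refl)

      covers : ∀ {N : Monoid c ℓ} (f : Monoid.Carrier N → ℤ²) →
        ∃[ n ] f n ≈ P → ∃[ n ] f n ≈ Q →
        ∀ {R} → ∃[ C ] C ∈ X × position C ≡ R → ∃[ n ] f n ≈ R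
      covers f f≈P f≈Q (_ , C∈ , refl) with proj₁ X≐ C∈
      ... | inj₁ refl = f≈P
      ... | inj₂ refl = f≈Q

    independent⇒ℕ² : cross P Q ≢ 0ℤ → toMonoid ≅ ℕ²-monoid
    independent⇒ℕ² P×Q≢0 = monomorphism⇒≅ {N = ℕ²-monoid}
      (combination-isMonoidMonomorphism P×Q≢0)
      (λ (m , n) → ∙-closed (multiples∈ A∈ m) (multiples∈ B∈ n))
      (covers {N = ℕ²-monoid} (combination P Q)
        ((1 , 0) , ≈-trans (Monoid.identityʳ ℤ²-monoid _) (1· P))
        ((0 , 1) , ≈-trans (Monoid.identityˡ ℤ²-monoid _) (1· Q)))

    private
      ·D-mono : ∀ k D → P ≡ k · D →
        IsMonoidMonomorphism (Monoid.rawMonoid ℤ-monoid) (Monoid.rawMonoid ℤ²-monoid) (_· D)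
      ·D-mono k D P≡kD = ·-isMonoidMonomorphism (divisor≢O A k P≡kD)

    codirectional⇒⊆ℕ : A ≢ B → cross P Q ≡ 0ℤ → ∃[ n ] dot P Q ≡ + n →
      ∃[ S ] TwoGenerated ℕ-monoid {0ℓ} S × toMonoid ≅ Submonoid.toMonoid S
    codirectional⇒⊆ℕ A≢B P×Q≡0 (n , d≡n) with common-divisor P Q (position≢O A) P×Q≡0
    -- A negative `b` would make the dot product negative.
    ... | _ , -[1+ b ] , _ , _ , _ , _ , g , d≡bg =
      contradiction (trans (sym d≡n) d≡bg) λ ()
    ... | a , + b , D , _ , P≡aD , Q≡bD , _ =
      S , (suc a , b , a≢b , id , id) , monomorphism⇒≅ {N = Submonoid.toMonoid S}
        (isMonoidMonomorphism ≈-trans (inclusion-isMonoidMonomorphism S) +·D-mono)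
        -- The n with nD in `𝒜 X` form a submonoid of ℕ containing both generators of `S`.
        (λ (n , n∈) → generated-least (preimage (isMonoidHomomorphism +·D-mono) (𝒜 X)) a,b∈ n∈)
        (covers {N = Submonoid.toMonoid S} (λ n → + proj₁ n · D)
          ((suc a , generator (inj₁ refl)) , ≈-sym (reflexive P≡aD))
          ((b , generator (inj₂ refl)) , ≈-sym (reflexive Q≡bD)))
      where
      S = generatedBy ℕ-monoid (｛ suc a ｝ ∪ ｛ b ｝)
      +·D-mono = isMonoidMonomorphism ≈-trans +-isMonoidMonomorphism (·D-mono (+ suc a) D P≡aD)

      -- Equal coefficients would put both steps at the same multiple of `D`.
      a≢b : suc a ≢ b
      a≢b refl = A≢B (steps-≡ (trans P≡aD (sym Q≡bD)))

      a,b∈ : ∀ {n} → n ∈ ｛ suc a ｝ ∪ ｛ b ｝ → + n · D ∈ Member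
      a,b∈ (inj₁ refl) = step∈ A∈ (reflexive P≡aD)
      a,b∈ (inj₂ refl) = step∈ B∈ (reflexive Q≡bD)

    opposite⇒ℤ : cross P Q ≡ 0ℤ → ∃[ n ] dot P Q ≡ -[1+ n ] → toMonoid ≅ ℤ-monoid
    opposite⇒ℤ P×Q≡0 (n , d≡-n) with common-divisor P Q (position≢O A) P×Q≡0
    ... | _ , + b , _ , _ , _ , _ , g , d≡bg =
      contradiction (trans (ℤ.pos-* b (suc g)) (trans (sym d≡bg) d≡-n)) λ ()
    ... | a , -[1+ b ] , D , coprime , P≡aD , Q≡bD , _ =
      monomorphism⇒≅ {N = ℤ-monoid} mono
        -- The scalars k with kD in `𝒜 X` include coprime integers of opposite sign, hence all of ℤ.
        (coprime⇒full (preimage (isMonoidHomomorphism mono) (𝒜 X)) coprime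
          (step∈ A∈ (reflexive P≡aD)) (step∈ B∈ (reflexive Q≡bD)))
        (covers {N = ℤ-monoid} (_· D)
          (+ suc a , ≈-sym (reflexive P≡aD)) (-[1+ b ] , ≈-sym (reflexive Q≡bD)))
      where
      mono = ·D-mono (+ suc a) D P≡aD

proposition2p11 : ∀ {p : Level} (X : StepSet p) →
    (∀ A → X ≐ ｛ A ｝ → Submonoid.toMonoid (𝒜 X) ≅ ℕ-monoid)
    × (∀ A B → X ≐ ｛ A ｝ ∪ ｛ B ｝ → A ≢ B → ∠ A B ≈∠ 0∠ →
    ∃[ S ] TwoGenerated ℕ-monoid {0ℓ} S × Submonoid.toMonoid (𝒜 X) ≅ Submonoid.toMonoid S)
    × (∀ A B → X ≐ ｛ A ｝ ∪ ｛ B ｝ → ∠ A B ≈∠ π →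
    Submonoid.toMonoid (𝒜 X) ≅ ℤ-monoid)
    × (∀ A B → X ≐ ｛ A ｝ ∪ ｛ B ｝ → 0∠ <∠ ∠ A B → ∠ A B <∠ π →
    Submonoid.toMonoid (𝒜 X) ≅ ℕ²-monoid)
proposition2p11 X =
    singleton⇒ℕ X
  , (λ A B X≐ A≢B ∠≈0 → let P×Q≡0 , d≥0 = ∠≈0⇒ A B ∠≈0 in codirectional⇒⊆ℕ X X≐ A≢B P×Q≡0 d≥0)
  , (λ A B X≐ ∠≈π → let P×Q≡0 , d<0 = ∠≈π⇒ A B ∠≈π in opposite⇒ℤ X X≐ P×Q≡0 d<0)
  , (λ A B X≐ 0<∠ ∠<π → independent⇒ℕ² X X≐ (0<∠<π⇒cross≢0 A B 0<∠ ∠<π))
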